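{- Let $k \ge 2$ be an integer. Let $a$ be a nonnegative integer satisfying $a \le \lfloor k!\,e \rfloor - R_k(3) + 1$, and let $q = a/k!$. Then $R_n(3) \le n!(e-q)+1$ for all integers $n \ge k$.
   Context: For an integer $n \ge 1$, the $n$-color Ramsey number $R_n(3) = R(3,\dots,3)$ denotes the smallest positive integer $N$ such that, for any coloring of the edges of the complete graph $K_N$ with $n$ colors, there is a monochromatic triangle. Here $e$ denotes the base of the natural logarithm, and $\lfloor x \rfloor$ is the integer part (floor) of the real number $x$. -}

module Defs where

open import Data.Empty using (⊥-elim)
open import Data.Fin.Base as Fin using (Fin; zero; suc)
import Data.Fin.Properties as Finₚ
open import Data.Integer.Base as ℤ using (ℤ; +_; 1ℤ; +≤+)
import Data.Integer.Properties as ℤₚ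
open import Data.List.Base using (List; []; _∷_; length; filter; allFin)
import Data.List.Properties as Listₚ
open import Data.List.Membership.Propositional using (_∈_; find)
open import Data.List.Membership.Propositional.Properties using (∈-allFin; ∈-filter⁺)
open import Data.List.Relation.Unary.All as All using (All; []; _∷_)
import Data.List.Relation.Unary.All.Properties as Allₚ
open import Data.List.Relation.Unary.AllPairs as AllPairs using (AllPairs; []; _∷_)
import Data.List.Relation.Unary.AllPairs.Properties as AllPairsₚ
open import Data.List.Relation.Unary.Any as Any using (Any; here; there)
open import Data.Nat.Base as ℕ using (ℕ; zero; suc; _!; z≤n; s≤s)
import Data.Nat.Properties as ℕₚ
open import Data.Product using (∃; ∃-syntax; _×_; _,_; proj₁; proj₂)
open import Data.Rational.Base as ℚ using (ℚ; mkℚ; 0ℚ; 1ℚ; _/_; toℚᵘ; ∣_∣)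
import Data.Rational.Properties as ℚₚ
open import Data.Rational.Solver using (module +-*-Solver)
open import Data.Rational.Unnormalised.Base as ℚᵘ using (mkℚᵘ; *≤*)
import Data.Rational.Unnormalised.Properties as ℚᵘₚ
open import Data.Sum using (_⊎_; inj₁; inj₂)
open import Data.Vec.Base as Vec using (Vec; []; _∷_; lookup; tabulate)
import Data.Vec.Properties as Vecₚ
open import Function using (_∘_; case_of_)
open import Relation.Binary.PropositionalEquality
open import Relation.Nullary

-- An edge {i , j} of the complete graph on Fin N is represented by its
-- endpoints in increasing order.
Colouring : (n N : ℕ) → Set
Colouring n N = (i j : Fin N) → .(i Fin.< j) → Fin n

MonochromaticTriangle : ∀ {n N} → Colouring n N → Set
MonochromaticTriangle {N = N} c =
  ∃[ i ] ∃[ j ] ∃[ l ] ∃ λ (i<j : i Fin.< j) → ∃ λ (j<l : j Fin.< l) →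
    c i j i<j ≡ c j l j<l × c i j i<j ≡ c i l (Finₚ.<-trans i<j j<l)

Forces : (n N : ℕ) → Set
Forces n N = (c : Colouring n N) → MonochromaticTriangle c

IsRamseyNumber : (n N : ℕ) → Set
IsRamseyNumber n N =
  1 ℕ.≤ N × Forces n N × (∀ M → 1 ℕ.≤ M → Forces n M → N ℕ.≤ M)

-- Existence of the Ramsey numbers.  It takes Ramsey's theorem (with a crude
-- bound) and, for the minimum to be constructible, decidability of `Forces`.

private

  Triangle : ∀ {n N} → (Fin N → Fin N → Fin n) → Set
  Triangle χ = ∃[ i ] ∃[ j ] ∃[ l ] (i Fin.< j × j Fin.< l ×
                                     χ i j ≡ χ j l × χ i j ≡ χ i l)

  triangle? : ∀ {n N} (χ : Fin N → Fin N → Fin n) → Dec (Triangle χ)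
  triangle? χ = Finₚ.any? λ i → Finₚ.any? λ j → Finₚ.any? λ l →
    (i Finₚ.<? j) ×-dec (j Finₚ.<? l) ×-dec
    (χ i j Finₚ.≟ χ j l) ×-dec (χ i j Finₚ.≟ χ i l)

  extend : ∀ {n N} → Colouring (suc n) N → Fin N → Fin N → Fin (suc n)
  extend c i j with i Finₚ.<? j
  ... | yes i<j = c i j i<j
  ... | no  _   = zero

  extend-< : ∀ {n N} (c : Colouring (suc n) N) {i j} (i<j : i Fin.< j) →
             extend c i j ≡ c i j i<j
  extend-< c {i} {j} i<j with i Finₚ.<? j
  ... | yes _   = refl
  ... | no  i≮j = ⊥-elim (i≮j i<j)

  extend-triangle : ∀ {n N} (c : Colouring (suc n) N) →
                    Triangle (extend c) → MonochromaticTriangle c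
  extend-triangle c (i , j , l , i<j , j<l , p , q) =
    i , j , l , i<j , j<l ,
    trans (sym (extend-< c i<j)) (trans p (extend-< c j<l)) ,
    trans (sym (extend-< c i<j)) (trans q (extend-< c (Finₚ.<-trans i<j j<l)))

  Searchable : Set → Set₁
  Searchable A = ∀ {P : A → Set} → (∀ a → Dec (P a)) → Dec (∀ a → P a)

  vec-searchable : ∀ {A} → Searchable A → ∀ m → Searchable (Vec A m)
  vec-searchable s zero    P? with P? []
  ... | yes p = yes λ { [] → p }
  ... | no ¬p = no λ f → ¬p (f [])
  vec-searchable s (suc m) P?
    with s (λ a → vec-searchable s m (λ v → P? (a ∷ v)))
  ... | yes p = yes λ { (a ∷ v) → p a v }
  ... | no ¬p = no λ f → ¬p (λ a v → f (a ∷ v))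

  forces? : ∀ n N → Dec (Forces n N)
  forces? zero    zero          = no λ f → case f (λ ()) of λ { (() , _) }
  forces? zero    (suc zero)    = no λ f → case f c of λ
    { (zero , zero , _ , () , _) }
    where
    c : Colouring 0 1
    c zero zero ()
  forces? zero    (suc (suc N)) = yes λ c →
    case c zero (suc zero) (s≤s z≤n) of λ ()
  forces? (suc n) N
    with vec-searchable (vec-searchable Finₚ.all? N) N
           (λ v → triangle? (λ i j → lookup (lookup v i) j))
  ... | yes t = yes λ c → extend-triangle c (transport c (t (table c)))
    where
    table : Colouring (suc n) N → Vec (Vec (Fin (suc n)) N) N
    table c = tabulate λ i → tabulate λ j → extend c i j

    at : ∀ c i j → lookup (lookup (table c) i) j ≡ extend c i j
    at c i j = trans (cong (λ r → lookup r j) (Vecₚ.lookup∘tabulate _ i))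
                     (Vecₚ.lookup∘tabulate _ j)

    transport : ∀ c → Triangle (λ i j → lookup (lookup (table c) i) j) →
                Triangle (extend c)
    transport c (i , j , l , i<j , j<l , p , q) =
      i , j , l , i<j , j<l ,
      trans (sym (at c i j)) (trans p (at c j l)) ,
      trans (sym (at c i j)) (trans q (at c i l))
  ... | no ¬t = no λ f → ¬t λ v →
    case f (λ i j _ → lookup (lookup v i) j) of λ
      { (i , j , l , i<j , j<l , p , q) → i , j , l , i<j , j<l , p , q }

  length-split : ∀ {A : Set} {P : A → Set} (P? : ∀ a → Dec (P a)) xs →
    length (filter P? xs) ℕ.+ length (filter (¬? ∘ P?) xs) ≡ length xs
  length-split P? []       = refl
  length-split P? (x ∷ xs) with P? x
  ... | yes _ = cong suc (length-split P? xs)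
  ... | no  _ = trans (ℕₚ.+-suc _ _) (cong suc (length-split P? xs))

  pigeonhole : ∀ {A : Set} {n} (f : A → Fin n) L b xs →
    All (λ x → f x ∈ L) xs → length L ℕ.* b ℕ.< length xs →
    ∃[ d ] (d ∈ L × b ℕ.≤ length (filter (λ x → f x Finₚ.≟ d) xs))
  pigeonhole f []      b (x ∷ xs) (() ∷ _) _
  pigeonhole f (d ∷ L) b xs all lt
    with b ℕₚ.≤? length (filter (λ x → f x Finₚ.≟ d) xs)
  ... | yes b≤ = d , here refl , b≤
  ... | no  b≰ = d′ , there d′∈L , ℕₚ.≤-trans b≤ shrink
    where
    f≟ : ∀ e x → Dec (f x ≡ e)
    f≟ e x = f x Finₚ.≟ e

    rest : List _
    rest = filter (¬? ∘ f≟ d) xs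

    rest-all : All (λ x → f x ∈ L) rest
    rest-all = All.zipWith
      (λ { (≢d , here ≡d) → ⊥-elim (≢d ≡d) ; (_ , there ∈L) → ∈L })
      (Allₚ.all-filter (¬? ∘ f≟ d) xs , Allₚ.filter⁺ (¬? ∘ f≟ d) all)

    rest-long : length L ℕ.* b ℕ.< length rest
    rest-long = ℕₚ.+-cancelˡ-< b _ _ (ℕₚ.<-≤-trans lt (ℕₚ.≤-trans
      (ℕₚ.≤-reflexive (sym (length-split (f≟ d) xs)))
      (ℕₚ.+-monoˡ-≤ _ (ℕₚ.<⇒≤ (ℕₚ.≰⇒> b≰)))))

    ih = pigeonhole f L b rest rest-all rest-long
    d′ = proj₁ ih
    d′∈L = proj₁ (proj₂ ih)
    b≤ = proj₂ (proj₂ ih)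

    filter-rest : ∀ zs → length (filter (f≟ d′) (filter (¬? ∘ f≟ d) zs))
                         ℕ.≤ length (filter (f≟ d′) zs)
    filter-rest []       = z≤n
    filter-rest (z ∷ zs) with f≟ d z
    filter-rest (z ∷ zs) | yes _ with f≟ d′ z
    ... | yes _ = ℕₚ.m≤n⇒m≤1+n (filter-rest zs)
    ... | no  _ = filter-rest zs
    filter-rest (z ∷ zs) | no _ with f≟ d′ z
    ... | yes _ = s≤s (filter-rest zs)
    ... | no  _ = filter-rest zs

    shrink = filter-rest xs

  bound : ℕ → ℕ
  bound zero    = 2
  bound (suc m) = 2 ℕ.+ suc m ℕ.* bound m

  module _ {n N} (χ : Fin N → Fin N → Fin n) where

    monoPair : ∀ d ys → AllPairs Fin._<_ ys →
      (∃[ y ] ∃[ z ] (y ∈ ys × z ∈ ys × y Fin.< z × χ y z ≡ d))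
      ⊎ AllPairs (λ y z → χ y z ≢ d) ys
    monoPair d []       []         = inj₂ []
    monoPair d (y ∷ ys) (y< ∷ ys<) with Any.any? (λ z → χ y z Finₚ.≟ d) ys
    ... | yes a = let z , z∈ , eq = find a in
      inj₁ (y , z , here refl , there z∈ , All.lookup y< z∈ , eq)
    ... | no ¬a with monoPair d ys ys<
    ...   | inj₁ (u , v , u∈ , v∈ , r) = inj₁ (u , v , there u∈ , there v∈ , r)
    ...   | inj₂ ap = inj₂ (Allₚ.¬Any⇒All¬ ys ¬a ∷ ap)

    ramsey : ∀ m L xs → length L ℕ.≤ m → bound m ℕ.≤ length xs →
      AllPairs Fin._<_ xs → AllPairs (λ i j → χ i j ∈ L) xs → Triangle χ
    ramsey zero [] (x ∷ y ∷ xs) _ _ _ ((() ∷ _) ∷ _)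
    ramsey zero L (_ ∷ []) _ (s≤s ()) _ _
    ramsey (suc m) L (x ∷ ys) |L|≤ (s≤s long) (x< ∷ ys<) (x∈ ∷ ys∈)
      with pigeonhole (χ x) L (bound m) ys x∈
             (ℕₚ.≤-<-trans (ℕₚ.*-monoˡ-≤ (bound m) |L|≤) long)
    ... | d , d∈L , many
      with monoPair d (filter (λ y → χ x y Finₚ.≟ d) ys)
             (AllPairsₚ.filter⁺ (λ y → χ x y Finₚ.≟ d) ys<)
    ...   | inj₁ (y , z , y∈ , z∈ , y<z , eq) =
            x , y , z , All.lookup near y∈ , y<z ,
            trans (All.lookup blue y∈) (sym eq) ,
            trans (All.lookup blue y∈) (sym (All.lookup blue z∈))
      where
      near = Allₚ.filter⁺ (λ y → χ x y Finₚ.≟ d) x<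
      blue = Allₚ.all-filter (λ y → χ x y Finₚ.≟ d) ys
    ...   | inj₂ none =
            ramsey m (filter (λ e → ¬? (e Finₚ.≟ d)) L)
              (filter (λ y → χ x y Finₚ.≟ d) ys)
              (ℕₚ.≤-pred (ℕₚ.<-≤-trans fewer |L|≤)) many
              (AllPairsₚ.filter⁺ (λ y → χ x y Finₚ.≟ d) ys<)
              (AllPairs.zipWith
                (λ { (≢d , ∈L) → ∈-filter⁺ (λ e → ¬? (e Finₚ.≟ d)) ∈L ≢d })
                (none , AllPairsₚ.filter⁺ (λ y → χ x y Finₚ.≟ d) ys∈))
      where
      fewer = Listₚ.filter-notAll (λ e → ¬? (e Finₚ.≟ d)) L
                (Any.map (λ d≡e e≢d → e≢d (sym d≡e)) d∈L)

  forces-some : ∀ n → ∃[ m ] Forces n (suc m)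
  forces-some zero    = 1 , λ c → case c zero (suc zero) (s≤s z≤n) of λ ()
  forces-some (suc n) = _ , λ c → extend-triangle c
    (ramsey (extend c) (suc n) (allFin (suc n)) (allFin (bound (suc n)))
      (ℕₚ.≤-reflexive (Listₚ.length-tabulate (λ i → i)))
      (ℕₚ.≤-reflexive (sym (Listₚ.length-tabulate (λ i → i))))
      (AllPairsₚ.tabulate⁺-< {f = λ i → i} (λ i<j → i<j))
      (AllPairsₚ.tabulate⁺-< {f = λ i → i} (λ _ → ∈-allFin _)))

  least : ∀ {P : ℕ → Set} → (∀ m → Dec (P m)) → ∀ b → P b →
          ∃[ m ] (P m × (∀ j → P j → m ℕ.≤ j))
  least P? b pb with P? 0
  ... | yes p0 = 0 , p0 , λ _ _ → z≤n
  least P? zero    pb | no ¬p0 = ⊥-elim (¬p0 pb)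
  least P? (suc b) pb | no ¬p0 with least (P? ∘ suc) b pb
  ... | m , pm , min = suc m , pm ,
    λ { zero p0 → ⊥-elim (¬p0 p0) ; (suc j) pj → s≤s (min j pj) }

-- For n = 0 the value is 2: K₂ has no colouring with no colours.
ramseyNumber : ∀ n → ∃[ N ] IsRamseyNumber n N
ramseyNumber n =
  let b , fb = forces-some n
      m , fm , min = least (λ m → forces? n (suc m)) b fb
  in suc m , s≤s z≤n , fm , λ { (suc j) _ fj → s≤s (min j fj) }

R₃ : ℕ → ℕ
R₃ n = proj₁ (ramseyNumber n)

R₃-isRamseyNumber : ∀ n → IsRamseyNumber n (R₃ n)
R₃-isRamseyNumber n = proj₂ (ramseyNumber n)

-- Reals are Cauchy sequences of rationals; operations are termwise, and the
-- order (hence equality) is insensitive to the choice of sequence.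

IsCauchy : (ℕ → ℚ) → Set
IsCauchy x = ∀ ε → 0ℚ ℚ.< ε →
  ∃[ N ] (∀ m n → N ℕ.≤ m → N ℕ.≤ n → ∣ x m ℚ.- x n ∣ ℚ.≤ ε)

record ℝ : Set where
  constructor mkℝ
  field
    seq    : ℕ → ℚ
    cauchy : IsCauchy seq

open ℝ public

infix  4 _≤ᴿ_ _<ᴿ_
infixl 6 _+ᴿ_ _-ᴿ_
infixl 7 _*ᴿ_

_≤ᴿ_ : ℝ → ℝ → Set
x ≤ᴿ y = ∀ ε → 0ℚ ℚ.< ε → ∃[ N ] (∀ n → N ℕ.≤ n → seq x n ℚ.≤ seq y n ℚ.+ ε)

_<ᴿ_ : ℝ → ℝ → Set
x <ᴿ y = ∃[ ε ] (0ℚ ℚ.< ε × ∃[ N ] (∀ n → N ℕ.≤ n → seq x n ℚ.+ ε ℚ.≤ seq y n))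

private

  open +-*-Solver using (solve; _:+_; _:*_; _:-_; :-_; _:=_; con)

  m⊔n≤o⇒ : ∀ {m n o} → m ℕ.⊔ n ℕ.≤ o → m ℕ.≤ o × n ℕ.≤ o
  m⊔n≤o⇒ {m} {n} p = ℕₚ.m⊔n≤o⇒m≤o m n p , ℕₚ.m⊔n≤o⇒n≤o m n p

  ½*-pos : ∀ ε → 0ℚ ℚ.< ε → 0ℚ ℚ.< ℚ.½ ℚ.* ε
  ½*-pos ε 0<ε = subst (ℚ._< ℚ.½ ℚ.* ε) (ℚₚ.*-zeroʳ ℚ.½)
    (ℚₚ.*-monoʳ-<-pos ℚ.½ 0<ε)

  ½+½ : ∀ ε → ℚ.½ ℚ.* ε ℚ.+ ℚ.½ ℚ.* ε ≡ ε
  ½+½ = solve 1 (λ e → con ℚ.½ :* e :+ con ℚ.½ :* e := e) refl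

  +-cauchy : ∀ {x y} → IsCauchy x → IsCauchy y → IsCauchy (λ n → x n ℚ.+ y n)
  +-cauchy {x} {y} cx cy ε 0<ε =
    let N₁ , p = cx _ (½*-pos ε 0<ε)
        N₂ , q = cy _ (½*-pos ε 0<ε)
    in N₁ ℕ.⊔ N₂ , λ m n N≤m N≤n →
      let m₁ , m₂ = m⊔n≤o⇒ N≤m
          n₁ , n₂ = m⊔n≤o⇒ N≤n
      in begin
        ∣ (x m ℚ.+ y m) ℚ.- (x n ℚ.+ y n) ∣
          ≡⟨ cong ∣_∣ (solve 4 (λ a b c d →
               (a :+ b) :- (c :+ d) := (a :- c) :+ (b :- d))
               refl (x m) (y m) (x n) (y n)) ⟩
        ∣ (x m ℚ.- x n) ℚ.+ (y m ℚ.- y n) ∣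
          ≤⟨ ℚₚ.∣p+q∣≤∣p∣+∣q∣ (x m ℚ.- x n) (y m ℚ.- y n) ⟩
        ∣ x m ℚ.- x n ∣ ℚ.+ ∣ y m ℚ.- y n ∣
          ≤⟨ ℚₚ.+-mono-≤ (p m n m₁ n₁) (q m n m₂ n₂) ⟩
        ℚ.½ ℚ.* ε ℚ.+ ℚ.½ ℚ.* ε
          ≡⟨ ½+½ ε ⟩
        ε ∎
    where open ℚₚ.≤-Reasoning

  neg-cauchy : ∀ {x} → IsCauchy x → IsCauchy (λ n → ℚ.- x n)
  neg-cauchy {x} cx ε 0<ε =
    let N , p = cx ε 0<ε
    in N , λ m n N≤m N≤n → subst (ℚ._≤ ε)
      (trans (sym (ℚₚ.∣-p∣≡∣p∣ (x m ℚ.- x n)))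
        (cong ∣_∣ (solve 2 (λ a b → :- (a :- b) := :- a :- (:- b)) refl (x m) (x n))))
      (p m n N≤m N≤n)

  eventuallyBounded : ∀ {x} → IsCauchy x →
    ∃[ B ] (ℚ.Positive B × ∃[ N ] (∀ n → N ℕ.≤ n → ∣ x n ∣ ℚ.≤ B))
  eventuallyBounded {x} cx =
    let N , p = cx 1ℚ (ℚₚ.positive⁻¹ 1ℚ)
    in ∣ x N ∣ ℚ.+ 1ℚ ,
       ℚₚ.nonNeg+pos⇒pos ∣ x N ∣ {{ℚₚ.∣-∣-nonNeg (x N)}} 1ℚ ,
       N , λ n N≤n → begin
         ∣ x n ∣
           ≡⟨ cong ∣_∣ (solve 2 (λ a b → a := b :+ (a :- b)) refl (x n) (x N)) ⟩
         ∣ x N ℚ.+ (x n ℚ.- x N) ∣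
           ≤⟨ ℚₚ.∣p+q∣≤∣p∣+∣q∣ (x N) (x n ℚ.- x N) ⟩
         ∣ x N ∣ ℚ.+ ∣ x n ℚ.- x N ∣
           ≤⟨ ℚₚ.+-monoʳ-≤ ∣ x N ∣ (p n N N≤n ℕₚ.≤-refl) ⟩
         ∣ x N ∣ ℚ.+ 1ℚ ∎
    where open ℚₚ.≤-Reasoning

  ∣*∣-mono : ∀ p q {B C} → ℚ.Positive B → ∣ p ∣ ℚ.≤ B → ∣ q ∣ ℚ.≤ C →
             ∣ p ℚ.* q ∣ ℚ.≤ B ℚ.* C
  ∣*∣-mono p q {B} {C} B>0 p≤B q≤C = begin
    ∣ p ℚ.* q ∣       ≡⟨ ℚₚ.∣p*q∣≡∣p∣*∣q∣ p q ⟩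
    ∣ p ∣ ℚ.* ∣ q ∣   ≤⟨ ℚₚ.*-monoʳ-≤-nonNeg ∣ q ∣ {{ℚₚ.∣-∣-nonNeg q}} p≤B ⟩
    B ℚ.* ∣ q ∣       ≤⟨ ℚₚ.*-monoˡ-≤-nonNeg B {{ℚₚ.pos⇒nonNeg B {{B>0}}}} q≤C ⟩
    B ℚ.* C           ∎
    where open ℚₚ.≤-Reasoning

  *-cauchy : ∀ {x y} → IsCauchy x → IsCauchy y → IsCauchy (λ n → x n ℚ.* y n)
  *-cauchy {x} {y} cx cy ε 0<ε =
    N , λ m n N≤m N≤n →
      let m₁₂ , m₃₄ = m⊔n≤o⇒ {N₁ ℕ.⊔ N₂} N≤m
          n₁₂ , n₃₄ = m⊔n≤o⇒ {N₁ ℕ.⊔ N₂} N≤n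
          m₁ , _  = m⊔n≤o⇒ {N₁} m₁₂
          _  , n₂ = m⊔n≤o⇒ {N₁} n₁₂
          m₃ , m₄ = m⊔n≤o⇒ {N₃} m₃₄
          n₃ , n₄ = m⊔n≤o⇒ {N₃} n₃₄
      in begin
        ∣ x m ℚ.* y m ℚ.- x n ℚ.* y n ∣
          ≡⟨ cong ∣_∣ (solve 4 (λ a b c d →
               a :* b :- c :* d := a :* (b :- d) :+ d :* (a :- c))
               refl (x m) (y m) (x n) (y n)) ⟩
        ∣ x m ℚ.* (y m ℚ.- y n) ℚ.+ y n ℚ.* (x m ℚ.- x n) ∣
          ≤⟨ ℚₚ.∣p+q∣≤∣p∣+∣q∣ (x m ℚ.* (y m ℚ.- y n)) (y n ℚ.* (x m ℚ.- x n)) ⟩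
        ∣ x m ℚ.* (y m ℚ.- y n) ∣ ℚ.+ ∣ y n ℚ.* (x m ℚ.- x n) ∣
          ≤⟨ ℚₚ.+-mono-≤
               (∣*∣-mono (x m) (y m ℚ.- y n) B>0 (p₁ m m₁) (p₄ m n m₄ n₄))
               (∣*∣-mono (y n) (x m ℚ.- x n) C>0 (p₂ n n₂) (p₃ m n m₃ n₃)) ⟩
        B ℚ.* δ ℚ.+ C ℚ.* δ
          ≡⟨ ℚₚ.*-distribʳ-+ δ B C ⟨
        D ℚ.* (ℚ.1/ D ℚ.* ε)
          ≡⟨ ℚₚ.*-assoc D (ℚ.1/ D) ε ⟨
        D ℚ.* ℚ.1/ D ℚ.* ε
          ≡⟨ cong (ℚ._* ε) (ℚₚ.*-inverseʳ D) ⟩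
        1ℚ ℚ.* ε
          ≡⟨ ℚₚ.*-identityˡ ε ⟩
        ε ∎
    where
    open ℚₚ.≤-Reasoning
    bx = eventuallyBounded {x} cx
    by = eventuallyBounded {y} cy
    B = proj₁ bx
    C = proj₁ by
    B>0 = proj₁ (proj₂ bx)
    C>0 = proj₁ (proj₂ by)
    N₁ = proj₁ (proj₂ (proj₂ bx))
    N₂ = proj₁ (proj₂ (proj₂ by))
    p₁ = proj₂ (proj₂ (proj₂ bx))
    p₂ = proj₂ (proj₂ (proj₂ by))
    D = B ℚ.+ C
    instance
      D>0 : ℚ.Positive D
      D>0 = ℚₚ.pos+pos⇒pos B {{B>0}} C {{C>0}}
      D≢0 : ℚ.NonZero D
      D≢0 = ℚₚ.pos⇒nonZero D
      1/D>0 : ℚ.Positive (ℚ.1/ D)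
      1/D>0 = ℚₚ.1/pos⇒pos D
    δ = ℚ.1/ D ℚ.* ε
    0<δ : 0ℚ ℚ.< δ
    0<δ = subst (ℚ._< δ) (ℚₚ.*-zeroʳ (ℚ.1/ D)) (ℚₚ.*-monoʳ-<-pos (ℚ.1/ D) 0<ε)
    N₃ = proj₁ (cx δ 0<δ)
    N₄ = proj₁ (cy δ 0<δ)
    p₃ = proj₂ (cx δ 0<δ)
    p₄ = proj₂ (cy δ 0<δ)
    N = (N₁ ℕ.⊔ N₂) ℕ.⊔ (N₃ ℕ.⊔ N₄)

fromℚ : ℚ → ℝ
fromℚ q = mkℝ (λ _ → q) λ ε 0<ε → 0 , λ _ _ _ _ →
  subst (λ z → ∣ z ∣ ℚ.≤ ε) (sym (ℚₚ.+-inverseʳ q)) (ℚₚ.<⇒≤ 0<ε)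

fromℤ : ℤ → ℝ
fromℤ i = fromℚ (i / 1)

fromℕ : ℕ → ℝ
fromℕ n = fromℤ (+ n)

_+ᴿ_ : ℝ → ℝ → ℝ
x +ᴿ y = mkℝ (λ n → seq x n ℚ.+ seq y n) (+-cauchy {seq x} {seq y} (cauchy x) (cauchy y))

_-ᴿ_ : ℝ → ℝ → ℝ
x -ᴿ y = mkℝ (λ n → seq x n ℚ.- seq y n)
             (+-cauchy {seq x} (cauchy x) (neg-cauchy {seq y} (cauchy y)))

_*ᴿ_ : ℝ → ℝ → ℝ
x *ᴿ y = mkℝ (λ n → seq x n ℚ.* seq y n) (*-cauchy {seq x} {seq y} (cauchy x) (cauchy y))

-- The floor is a relation because a total function ℝ → ℤ computing it does
-- not exist constructively.
IsFloor : ℝ → ℤ → Set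
IsFloor x m = fromℤ m ≤ᴿ x × x <ᴿ fromℤ m +ᴿ fromℕ 1

1/_! : ℕ → ℚ
1/ n ! = (+ 1 / n !) {{n ℕₚ.!≢0}}

-- The sum of 1/i! over 0 ≤ i ≤ n; e is the limit as n → ∞.
eSum : ℕ → ℚ
eSum zero    = 1/ 0 !
eSum (suc n) = eSum n ℚ.+ 1/ suc n !

private

  toℚᵘ-1/ : ∀ n .{{_ : ℕ.NonZero n}} → toℚᵘ (+ 1 / n) ℚᵘ.≃ (+ 1 ℚᵘ./ n)
  toℚᵘ-1/ (suc n) = ℚₚ.toℚᵘ-fromℚᵘ (mkℚᵘ (+ 1) n)

  1/-antimono : ∀ {m n} .{{_ : ℕ.NonZero m}} .{{_ : ℕ.NonZero n}} →
                m ℕ.≤ n → + 1 / n ℚ.≤ + 1 / m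
  1/-antimono {m@(suc _)} {n@(suc _)} m≤n = ℚₚ.toℚᵘ-cancel-≤ (begin
    toℚᵘ (+ 1 / n)   ≃⟨ toℚᵘ-1/ n ⟩
    + 1 ℚᵘ./ n       ≤⟨ *≤* (ℤₚ.*-monoˡ-≤-nonNeg (+ 1) (+≤+ m≤n)) ⟩
    + 1 ℚᵘ./ m       ≃⟨ toℚᵘ-1/ m ⟨
    toℚᵘ (+ 1 / m)   ∎)
    where open ℚᵘₚ.≤-Reasoning

  1/-double : ∀ {m n} .{{_ : ℕ.NonZero m}} .{{_ : ℕ.NonZero n}} →
              2 ℕ.* m ℕ.≤ n → + 1 / n ℚ.+ + 1 / n ℚ.≤ + 1 / m
  1/-double {m@(suc _)} {n@(suc _)} 2m≤n = ℚₚ.toℚᵘ-cancel-≤ (begin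
    toℚᵘ (+ 1 / n ℚ.+ + 1 / n)
      ≃⟨ ℚₚ.toℚᵘ-homo-+ (+ 1 / n) (+ 1 / n) ⟩
    toℚᵘ (+ 1 / n) ℚᵘ.+ toℚᵘ (+ 1 / n)
      ≃⟨ ℚᵘₚ.+-cong (toℚᵘ-1/ n) (toℚᵘ-1/ n) ⟩
    + 1 ℚᵘ./ n ℚᵘ.+ + 1 ℚᵘ./ n
      ≤⟨ *≤* (+≤+ (subst₂ ℕ._≤_ (lhs m n) (rhs n) (ℕₚ.*-monoʳ-≤ n 2m≤n))) ⟩
    + 1 ℚᵘ./ m
      ≃⟨ toℚᵘ-1/ m ⟨
    toℚᵘ (+ 1 / m) ∎)
    where
    open ℚᵘₚ.≤-Reasoning
    lhs : ∀ m n → n ℕ.* (2 ℕ.* m) ≡ (1 ℕ.* n ℕ.+ 1 ℕ.* n) ℕ.* m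
    lhs m n = trans (sym (ℕₚ.*-assoc n 2 m)) (cong (ℕ._* m)
      (trans (ℕₚ.*-comm n 2) (cong (ℕ._+ 1 ℕ.* n) (sym (ℕₚ.*-identityˡ n)))))
    rhs : ∀ n → n ℕ.* n ≡ 1 ℕ.* (n ℕ.* n)
    rhs n = sym (ℕₚ.*-identityˡ (n ℕ.* n))

  1/↧≤ : ∀ ε → 0ℚ ℚ.< ε → + 1 / ℚ.↧ₙ ε ℚ.≤ ε
  1/↧≤ ε@(mkℚ (+ suc p) d _) _ = ℚₚ.toℚᵘ-cancel-≤ (begin
    toℚᵘ (+ 1 / suc d)   ≃⟨ toℚᵘ-1/ (suc d) ⟩
    + 1 ℚᵘ./ suc d       ≤⟨ *≤* (ℤₚ.*-monoʳ-≤-nonNeg (+ suc d) {+ 1} {+ suc p} (+≤+ (s≤s z≤n))) ⟩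
    toℚᵘ ε               ∎)
    where open ℚᵘₚ.≤-Reasoning
  1/↧≤ (mkℚ (+ zero) d _)    (ℚ.*<* (ℤ.+<+ ()))
  1/↧≤ (mkℚ ℤ.-[1+ p ] d _) (ℚ.*<* ())

  n≤n! : ∀ n → n ℕ.≤ n !
  n≤n! zero    = z≤n
  n≤n! (suc n) = ℕₚ.m≤m*n (suc n) (n !) {{n ℕₚ.!≢0}}

  !-mono : ∀ {m n} → m ℕ.≤ n → m ! ℕ.≤ n !
  !-mono {n = n} z≤n = ℕₚ.n≢0⇒n>0 (ℕ.≢-nonZero⁻¹ (n !) {{n ℕₚ.!≢0}})
  !-mono (s≤s m≤n) = ℕₚ.*-mono-≤ (s≤s m≤n) (!-mono m≤n)

  0≤1/! : ∀ n → 0ℚ ℚ.≤ 1/ n !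
  0≤1/! n = ℚₚ.nonNegative⁻¹ _ {{ℚₚ.normalize-nonNeg 1 (n !) {{n ℕₚ.!≢0}}}}

  p≤p+q : ∀ p {q} → 0ℚ ℚ.≤ q → p ℚ.≤ p ℚ.+ q
  p≤p+q p {q} 0≤q = subst (ℚ._≤ p ℚ.+ q) (ℚₚ.+-identityʳ p) (ℚₚ.+-monoʳ-≤ p 0≤q)

  eSum-lower : ∀ m d → eSum m ℚ.≤ eSum (d ℕ.+ m)
  eSum-lower m zero    = ℚₚ.≤-refl
  eSum-lower m (suc d) = ℚₚ.≤-trans (eSum-lower m d) (p≤p+q _ (0≤1/! (suc d ℕ.+ m)))

  -- eSum n + 1/n! is nonincreasing for n ≥ 1.
  eSum-upper′ : ∀ m d → eSum (d ℕ.+ suc m) ℚ.+ 1/ (d ℕ.+ suc m) ! ℚ.≤ eSum (suc m) ℚ.+ 1/ suc m !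
  eSum-upper′ m zero    = ℚₚ.≤-refl
  eSum-upper′ m (suc d) = begin
    eSum n ℚ.+ 1/ suc n ! ℚ.+ 1/ suc n !
      ≡⟨ ℚₚ.+-assoc (eSum n) (1/ suc n !) (1/ suc n !) ⟩
    eSum n ℚ.+ (1/ suc n ! ℚ.+ 1/ suc n !)
      ≤⟨ ℚₚ.+-monoʳ-≤ (eSum n) (1/-double {{n ℕₚ.!≢0}} {{suc n ℕₚ.!≢0}}
           (ℕₚ.*-monoˡ-≤ (n !) (s≤s (ℕₚ.≤-trans (s≤s z≤n) (ℕₚ.m≤n+m (suc m) d))))) ⟩
    eSum n ℚ.+ 1/ n !
      ≤⟨ eSum-upper′ m d ⟩
    eSum (suc m) ℚ.+ 1/ suc m ! ∎
    where
    open ℚₚ.≤-Reasoning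
    n = d ℕ.+ suc m

  eSum-upper : ∀ m d → eSum (d ℕ.+ suc m) ℚ.≤ eSum (suc m) ℚ.+ 1/ suc m !
  eSum-upper m d = ℚₚ.≤-trans (p≤p+q _ (0≤1/! (d ℕ.+ suc m))) (eSum-upper′ m d)

  ∣p-q∣≤ : ∀ {p q r} → q ℚ.≤ p → p ℚ.≤ q ℚ.+ r → ∣ p ℚ.- q ∣ ℚ.≤ r
  ∣p-q∣≤ {p} {q} {r} q≤p p≤q+r = begin
    ∣ p ℚ.- q ∣        ≡⟨ ℚₚ.0≤p⇒∣p∣≡p (subst (ℚ._≤ p ℚ.- q) (ℚₚ.+-inverseʳ q)
                            (ℚₚ.+-monoˡ-≤ (ℚ.- q) q≤p)) ⟩
    p ℚ.- q            ≤⟨ ℚₚ.+-monoˡ-≤ (ℚ.- q) p≤q+r ⟩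
    q ℚ.+ r ℚ.- q      ≡⟨ solve 2 (λ a b → a :+ b :- a := b) refl q r ⟩
    r                  ∎
    where open ℚₚ.≤-Reasoning

  eSum-close : ∀ {m n} → suc m ℕ.≤ n → ∣ eSum n ℚ.- eSum (suc m) ∣ ℚ.≤ 1/ suc m !
  eSum-close {m} {n} m<n = subst (λ z → ∣ eSum z ℚ.- eSum (suc m) ∣ ℚ.≤ 1/ suc m !)
    (ℕₚ.m∸n+n≡m m<n)
    (∣p-q∣≤ (eSum-lower (suc m) (n ℕ.∸ suc m)) (eSum-upper m (n ℕ.∸ suc m)))

  eSum-cauchy : IsCauchy eSum
  eSum-cauchy ε 0<ε = ℚ.↧ₙ ε , go
    where
    small : ∀ m → ℚ.↧ₙ ε ℕ.≤ m → 1/ m ! ℚ.≤ ε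
    small m N≤m = ℚₚ.≤-trans
      (1/-antimono {{_}} {{m ℕₚ.!≢0}} (ℕₚ.≤-trans N≤m (n≤n! m))) (1/↧≤ ε 0<ε)

    go : ∀ m n → ℚ.↧ₙ ε ℕ.≤ m → ℚ.↧ₙ ε ℕ.≤ n → ∣ eSum m ℚ.- eSum n ∣ ℚ.≤ ε
    go m@(suc _) n@(suc _) N≤m N≤n with ℕₚ.≤-total m n
    ... | inj₂ n≤m = ℚₚ.≤-trans (eSum-close n≤m) (small n N≤n)
    ... | inj₁ m≤n = subst (ℚ._≤ ε)
      (trans (sym (ℚₚ.∣-p∣≡∣p∣ (eSum n ℚ.- eSum m)))
        (cong ∣_∣ (solve 2 (λ a b → :- (a :- b) := b :- a) refl (eSum n) (eSum m))))
      (ℚₚ.≤-trans (eSum-close m≤n) (small m N≤m))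

e : ℝ
e = mkℝ eSum eSum-cauchy

{-# OPTIONS --safe #-}

-- The neighbours of a vertex, grouped by colour, give the classical recursion
-- R (n+1) - 1 ≤ (n+1) (R n - 1) + 1.  The integers S n = n! Σ_{i≤n} 1/i!
-- satisfy it with equality, so a deficit R k - 1 ≤ S k - a propagates to
-- R n - 1 ≤ S n - a n!/k! ≤ n! (e - a/k!).  The hypothesis gives that deficit
-- because ⌊k! e⌋ ≤ S k.
module Submission where

open import Defs
open import Data.Fin.Base as Fin using (Fin; zero; suc; punchOut)
import Data.Fin.Properties as Finₚ
open import Data.Integer.Base as ℤ using (ℤ; +_; +≤+; +<+)
import Data.Integer.Properties as ℤₚ
import Data.Integer.Solver as ℤSolver
open import Data.Nat.Base as ℕ using (ℕ; zero; suc; _!; z≤n; s≤s; z<s; s<s; _≤′_; ≤′-refl; ≤′-step)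
import Data.Nat.Properties as ℕₚ
open import Data.Nat.Properties using (_!≢0)
import Data.Nat.Solver as ℕSolver
open import Data.Product using (∃; ∃-syntax; _×_; _,_; proj₁)
open import Data.Rational.Base as ℚ using (ℚ; 0ℚ; 1ℚ; _/_; toℚᵘ)
import Data.Rational.Properties as ℚₚ
import Data.Rational.Solver as ℚSolver
open import Data.Rational.Unnormalised.Base as ℚᵘ using (mkℚᵘ; *≡*; *≤*)
import Data.Rational.Unnormalised.Properties as ℚᵘₚ
open import Data.Sum using (_⊎_; inj₁; inj₂; map)
open import Function using (_∘_)
open import Relation.Binary.PropositionalEquality
open import Relation.Nullary using (Dec; yes; no; ¬_; recompute)
open import Relation.Nullary.Decidable using (map′)

module ℕS = ℕSolver.+-*-Solver
module ℤS = ℤSolver.+-*-Solver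
module ℚS = ℚSolver.+-*-Solver

-- Pigeonhole with order-preserving selections.

StrictlyIncreasing : ∀ {m N} → (Fin m → Fin N) → Set
StrictlyIncreasing g = ∀ {i j} → i Fin.< j → g i Fin.< g j

-- A subset is given by its increasing enumeration because a colouring is defined only on ordered
-- pairs: composing it with such a map yields a colouring of a smaller complete graph directly.
Selection : (m N : ℕ) → (Fin N → Set) → Set
Selection m N P = ∃ λ (g : Fin m → Fin N) → StrictlyIncreasing g × (∀ i → P (g i))

module _ {N} (P : Fin (suc N) → Set) where

  select-tail : ∀ {m} → Selection m N (P ∘ suc) → Selection m (suc N) P
  select-tail (g , g-inc , Pg) = suc ∘ g , s<s ∘ g-inc , Pg

  select-head : ∀ {m} → P zero → Selection m N (P ∘ suc) → Selection (suc m) (suc N) P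
  select-head {m} p (g , g-inc , Pg) = h , h-inc , Ph
    where
    h : Fin (suc m) → Fin (suc N)
    h zero    = zero
    h (suc i) = suc (g i)

    h-inc : StrictlyIncreasing h
    h-inc {zero}  {suc j} _         = z<s
    h-inc {suc i} {suc j} (s≤s i<j) = s<s (g-inc i<j)

    Ph : ∀ i → P (h i)
    Ph zero    = p
    Ph (suc i) = Pg i

select-none : ∀ {N} P → Selection 0 N P
select-none _ = (λ ()) , (λ {}) , λ ()

-- The points are read in order, and each spends one unit of the budget, `a` or `b`, of its class,
-- so `a + b < N` is preserved for the remaining points. A point whose class has budget zero already
-- completes that selection.
select-split : ∀ {N a b} {P : Fin N → Set} → (∀ i → Dec (P i)) → a ℕ.+ b ℕ.< N →
               Selection (suc a) N P ⊎ Selection (suc b) N (¬_ ∘ P)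
select-split {suc N} {a} {b} {P} P? a+b<N with P? zero
select-split {suc N} {zero}  {b} {P} P? _ | yes p =
  inj₁ (select-head P p (select-none (P ∘ suc)))
select-split {suc N} {suc a} {b} {P} P? (s≤s a+b<N) | yes p =
  map (select-head P p) (select-tail (¬_ ∘ P)) (select-split (P? ∘ suc) a+b<N)
select-split {suc N} {a} {zero}  {P} P? _ | no ¬p =
  inj₂ (select-head (¬_ ∘ P) ¬p (select-none (¬_ ∘ P ∘ suc)))
select-split {suc N} {a} {suc b} {P} P? (s≤s a+b<N) | no ¬p =
  map (select-tail P) (select-head (¬_ ∘ P) ¬p)
    (select-split (P? ∘ suc) (subst (ℕ._≤ N) (ℕₚ.+-suc a b) a+b<N))

-- Induction on the number of values: `select-split` with budgets `M` and `n * M` either settles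
-- value `zero` or leaves `n * M + 1` points avoiding it, on which `punchOut` turns `f` into a map
-- to `Fin n`.
pigeonhole : ∀ n {N} M (f : Fin N → Fin n) → n ℕ.* M ℕ.< N →
             ∃[ d ] Selection (suc M) N (λ i → f i ≡ d)
pigeonhole zero    {suc N} M f _ with () ← f zero
pigeonhole (suc n) M f lt with select-split (λ i → f i Finₚ.≟ zero) lt
... | inj₁ sel = zero , sel
... | inj₂ (g , g-inc , f≢0)
  with pigeonhole n M (λ i → punchOut (f≢0 i ∘ sym)) ℕₚ.≤-refl
...   | d , h , h-inc , eq =
  suc d , g ∘ h , g-inc ∘ h-inc ,
  λ i → trans (sym (Finₚ.punchIn-punchOut (f≢0 (h i) ∘ sym))) (cong suc (eq i))

-- The recursion for triangle Ramsey numbers.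

EdgeOfColour : ∀ {n N} → Colouring n N → Fin n → Set
EdgeOfColour c d = ∃[ i ] ∃[ j ] ∃ λ (i<j : i Fin.< j) → c i j i<j ≡ d

edgeOfColour? : ∀ {n N} (c : Colouring n N) d → Dec (EdgeOfColour c d)
edgeOfColour? c d = Finₚ.any? λ i → Finₚ.any? λ j → edge? i j
  where
  edge? : ∀ i j → Dec (∃ λ (i<j : i Fin.< j) → c i j i<j ≡ d)
  edge? i j with i Finₚ.<? j
  -- The order proof is an irrelevant argument of `c`, so one comparison of colours decides the
  -- claim for every such proof.
  ... | yes i<j = map′ (i<j ,_) (λ { (_ , eq) → eq }) (c i j i<j Finₚ.≟ d)
  ... | no  i≮j = no λ { (i<j , _) → i≮j i<j }

-- Deleting the absent colour by `punchOut` gives a colouring with `n` colours, and injectivity of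
-- `punchOut` carries its triangle back.
triangle-without-colour : ∀ {n N} (c : Colouring (suc n) N) d → ¬ EdgeOfColour c d →
                          Forces n N → MonochromaticTriangle c
triangle-without-colour {n} {N} c d ¬edge forces =
  let i , j , l , i<j , j<l , p , q = forces c′
  in i , j , l , i<j , j<l ,
     Finₚ.punchOut-injective (≢d i<j) (≢d j<l) p ,
     Finₚ.punchOut-injective (≢d i<j) (≢d (Finₚ.<-trans i<j j<l)) q
  where
  -- An edge of colour `d` needs a relevant order proof, which `recompute` recovers from
  -- decidability.
  ≢d : ∀ {i j} .(i<j : i Fin.< j) → d ≢ c i j i<j
  ≢d {i} {j} i<j eq = ¬edge (i , j , recompute (i Finₚ.<? j) i<j , sym eq)

  c′ : Colouring n N
  c′ i j i<j = punchOut (≢d i<j)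

-- Vertex `zero` has `suc n * M + 1` neighbours, so `M + 1` of them are joined to it in one colour
-- `d`. An edge of colour `d` among these closes a triangle at `zero`; otherwise they use only `n`
-- colours.
forces-step : ∀ n M → Forces n (suc M) → Forces (suc n) (suc (suc (suc n ℕ.* M)))
forces-step n M forces c with pigeonhole (suc n) M (λ i → c zero (suc i) z<s) ℕₚ.≤-refl
... | d , g , g-inc , toZero = go (edgeOfColour? c′ d)
  where
  c′ : Colouring (suc n) (suc M)
  c′ i j i<j = c (suc (g i)) (suc (g j)) (s<s (g-inc i<j))

  go : Dec (EdgeOfColour c′ d) → MonochromaticTriangle c
  go (yes (i , j , i<j , eq)) =
    zero , suc (g i) , suc (g j) , z<s , s<s (g-inc i<j) ,
    trans (toZero i) (sym eq) , trans (toZero i) (sym (toZero j))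
  go (no ¬edge) =
    let i , j , l , i<j , j<l , p , q = triangle-without-colour c′ d ¬edge forces
    in suc (g i) , suc (g j) , suc (g l) , s<s (g-inc i<j) , s<s (g-inc j<l) , p , q

ramsey-step : ∀ {n M M′} → IsRamseyNumber n (suc M) → IsRamseyNumber (suc n) (suc M′) →
              M′ ℕ.≤ suc (suc n ℕ.* M)
ramsey-step {n} {M} (_ , forces , _) (_ , _ , minimal) =
  ℕₚ.≤-pred (minimal _ (s≤s z≤n) (forces-step n M forces))

-- The comparison sequence and the induction step for the deficit.

S : ℕ → ℕ
S zero    = 1
S (suc n) = suc (suc n ℕ.* S n)

-- Applied with `t` = k! and `w` a factorial, so that `n * w` is the next factorial and
-- `suc (n * s)` the next value of `S`. Multiplying through by `t` keeps the deficit a n!/k! free of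
-- division.
scaled-bound-step : ∀ t a n w M M′ s →
                    t ℕ.* M ℕ.+ a ℕ.* w ℕ.≤ t ℕ.* s → M′ ℕ.≤ suc (n ℕ.* M) →
                    t ℕ.* M′ ℕ.+ a ℕ.* (n ℕ.* w) ℕ.≤ t ℕ.* suc (n ℕ.* s)
scaled-bound-step t a n w M M′ s ih M′≤ = begin
  t ℕ.* M′ ℕ.+ a ℕ.* (n ℕ.* w)
    ≤⟨ ℕₚ.+-monoˡ-≤ (a ℕ.* (n ℕ.* w)) (ℕₚ.*-monoʳ-≤ t M′≤) ⟩
  t ℕ.* suc (n ℕ.* M) ℕ.+ a ℕ.* (n ℕ.* w)
    ≡⟨ solve 5 (λ t a n w M → t :* (con 1 :+ n :* M) :+ a :* (n :* w)
         := t :+ n :* (t :* M :+ a :* w)) refl t a n w M ⟩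
  t ℕ.+ n ℕ.* (t ℕ.* M ℕ.+ a ℕ.* w)
    ≤⟨ ℕₚ.+-monoʳ-≤ t (ℕₚ.*-monoʳ-≤ n ih) ⟩
  t ℕ.+ n ℕ.* (t ℕ.* s)
    ≡⟨ solve 3 (λ t n s → t :+ n :* (t :* s) := t :* (con 1 :+ n :* s)) refl t n s ⟩
  t ℕ.* suc (n ℕ.* s) ∎
  where
  open ℕₚ.≤-Reasoning
  open ℕS

-- Integers inside the rationals.

toℚᵘ-/ : ∀ i d → toℚᵘ (i / suc d) ℚᵘ.≃ mkℚᵘ i d
toℚᵘ-/ i d = ℚₚ.toℚᵘ-fromℚᵘ (mkℚᵘ i d)

-- Definitionally the constant term of the sequence of `fromℤ i`, so termwise inequalities between
-- reals become inequalities about `ι`.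
ι : ℤ → ℚ
ι i = i / 1

ι-+ : ∀ i j → ι (i ℤ.+ j) ≡ ι i ℚ.+ ι j
ι-+ i j = ℚₚ.toℚᵘ-injective (begin
  toℚᵘ (ι (i ℤ.+ j))             ≈⟨ toℚᵘ-/ (i ℤ.+ j) 0 ⟩
  mkℚᵘ (i ℤ.+ j) 0
    ≈⟨ *≡* (cong (ℤ._* + 1) (sym (cong₂ ℤ._+_ (ℤₚ.*-identityʳ i) (ℤₚ.*-identityʳ j)))) ⟩
  mkℚᵘ i 0 ℚᵘ.+ mkℚᵘ j 0         ≈⟨ ℚᵘₚ.+-cong (toℚᵘ-/ i 0) (toℚᵘ-/ j 0) ⟨
  toℚᵘ (ι i) ℚᵘ.+ toℚᵘ (ι j)     ≈⟨ ℚₚ.toℚᵘ-homo-+ (ι i) (ι j) ⟨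
  toℚᵘ (ι i ℚ.+ ι j)             ∎)
  where open ℚᵘₚ.≃-Reasoning

ι-* : ∀ i j → ι (i ℤ.* j) ≡ ι i ℚ.* ι j
ι-* i j = ℚₚ.toℚᵘ-injective (begin
  toℚᵘ (ι (i ℤ.* j))             ≈⟨ toℚᵘ-/ (i ℤ.* j) 0 ⟩
  mkℚᵘ i 0 ℚᵘ.* mkℚᵘ j 0         ≈⟨ ℚᵘₚ.*-cong (toℚᵘ-/ i 0) (toℚᵘ-/ j 0) ⟨
  toℚᵘ (ι i) ℚᵘ.* toℚᵘ (ι j)     ≈⟨ ℚₚ.toℚᵘ-homo-* (ι i) (ι j) ⟨
  toℚᵘ (ι i ℚ.* ι j)             ∎)
  where open ℚᵘₚ.≃-Reasoning

ι-mono-≤ : ∀ {i j} → i ℤ.≤ j → ι i ℚ.≤ ι j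
ι-mono-≤ {i} {j} i≤j = ℚₚ.toℚᵘ-cancel-≤ (begin
  toℚᵘ (ι i)   ≃⟨ toℚᵘ-/ i 0 ⟩
  mkℚᵘ i 0     ≤⟨ *≤* (ℤₚ.*-monoʳ-≤-nonNeg (+ 1) i≤j) ⟩
  mkℚᵘ j 0     ≃⟨ toℚᵘ-/ j 0 ⟨
  toℚᵘ (ι j)   ∎)
  where open ℚᵘₚ.≤-Reasoning

ι-cancel-≤ : ∀ {i j} → ι i ℚ.≤ ι j → i ℤ.≤ j
ι-cancel-≤ {i} {j} ιi≤ιj = ℤₚ.*-cancelʳ-≤-pos i j (+ 1) (ℚᵘₚ.drop-*≤* (begin
  mkℚᵘ i 0     ≃⟨ toℚᵘ-/ i 0 ⟨
  toℚᵘ (ι i)   ≤⟨ ℚₚ.toℚᵘ-mono-≤ ιi≤ιj ⟩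
  toℚᵘ (ι j)   ≃⟨ toℚᵘ-/ j 0 ⟩
  mkℚᵘ j 0     ∎))
  where open ℚᵘₚ.≤-Reasoning

/-*-cancel : ∀ i d .{{_ : ℕ.NonZero d}} → (i / d) ℚ.* ι (+ d) ≡ ι i
/-*-cancel i (suc d) = ℚₚ.toℚᵘ-injective (begin
  toℚᵘ ((i / suc d) ℚ.* ι (+ suc d))          ≈⟨ ℚₚ.toℚᵘ-homo-* (i / suc d) (ι (+ suc d)) ⟩
  toℚᵘ (i / suc d) ℚᵘ.* toℚᵘ (ι (+ suc d))    ≈⟨ ℚᵘₚ.*-cong (toℚᵘ-/ i d) (toℚᵘ-/ (+ suc d) 0) ⟩
  mkℚᵘ i d ℚᵘ.* mkℚᵘ (+ suc d) 0              ≈⟨ *≡* cross ⟩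
  mkℚᵘ i 0                                    ≈⟨ toℚᵘ-/ i 0 ⟨
  toℚᵘ (ι i)                                  ∎)
  where
  open ℚᵘₚ.≃-Reasoning
  cross : i ℤ.* + suc d ℤ.* + 1 ≡ i ℤ.* + (suc d ℕ.* 1)
  cross = trans (ℤₚ.*-identityʳ (i ℤ.* + suc d)) (cong (λ z → i ℤ.* + z) (sym (ℕₚ.*-identityʳ (suc d))))

ι-pos-* : ∀ m n → ι (+ (m ℕ.* n)) ≡ ι (+ m) ℚ.* ι (+ n)
ι-pos-* m n = trans (cong ι (ℤₚ.pos-* m n)) (ι-* (+ m) (+ n))

instance
  ι-nonNeg : ∀ {n} → ℚ.NonNegative (ι (+ n))
  ι-nonNeg {n} = ℚₚ.normalize-nonNeg n 1

  ι!-pos : ∀ {n} → ℚ.Positive (ι (+ (n !)))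
  ι!-pos {n} = ℚₚ.normalize-pos (n !) 1 {{_}} {{n !≢0}}

-- Partial sums of e scaled by factorials.

1/!-nonNeg : ∀ n → ℚ.NonNegative (1/ n !)
1/!-nonNeg n = ℚₚ.normalize-nonNeg 1 (n !) {{n !≢0}}

1/!-inverse : ∀ n → 1/ n ! ℚ.* ι (+ (n !)) ≡ 1ℚ
1/!-inverse n = /-*-cancel (+ 1) (n !) {{n !≢0}}

1/!-suc : ∀ n → 1/ n ! ≡ ι (+ suc n) ℚ.* 1/ suc n !
1/!-suc n = begin
  x                        ≡⟨ ℚₚ.*-identityʳ x ⟨
  x ℚ.* 1ℚ                 ≡⟨ cong (x ℚ.*_) (1/!-inverse (suc n)) ⟨
  x ℚ.* (y ℚ.* ι (+ (suc n !)))  ≡⟨ cong (λ z → x ℚ.* (y ℚ.* z)) (ι-pos-* (suc n) (n !)) ⟩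
  x ℚ.* (y ℚ.* (s ℚ.* ι (+ (n !))))
    ≡⟨ solve 4 (λ x y s t → x :* (y :* (s :* t)) := x :* t :* (s :* y)) refl x y s (ι (+ (n !))) ⟩
  x ℚ.* ι (+ (n !)) ℚ.* (s ℚ.* y)  ≡⟨ cong (ℚ._* (s ℚ.* y)) (1/!-inverse n) ⟩
  1ℚ ℚ.* (s ℚ.* y)         ≡⟨ ℚₚ.*-identityˡ (s ℚ.* y) ⟩
  s ℚ.* y                  ∎
  where
  open ≡-Reasoning
  open ℚS
  x = 1/ n !
  y = 1/ suc n !
  s = ι (+ suc n)

-- Multiplication by (n+1)! turns the new term of the sum into 1 and the earlier ones into n+1 times
-- the previous value, which is the recursion defining `S`.
!*eSum : ∀ n → ι (+ (n !)) ℚ.* eSum n ≡ ι (+ S n)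
!*eSum zero    = refl
!*eSum (suc n) = begin
  t′ ℚ.* (eSum n ℚ.+ y)
    ≡⟨ solve 3 (λ t′ e y → t′ :* (e :+ y) := y :* t′ :+ t′ :* e) refl t′ (eSum n) y ⟩
  y ℚ.* t′ ℚ.+ t′ ℚ.* eSum n
    ≡⟨ cong₂ ℚ._+_ (1/!-inverse (suc n)) (cong (ℚ._* eSum n) (ι-pos-* (suc n) (n !))) ⟩
  1ℚ ℚ.+ s ℚ.* t ℚ.* eSum n
    ≡⟨ cong (1ℚ ℚ.+_) (ℚₚ.*-assoc s t (eSum n)) ⟩
  1ℚ ℚ.+ s ℚ.* (t ℚ.* eSum n)
    ≡⟨ cong (λ z → 1ℚ ℚ.+ s ℚ.* z) (!*eSum n) ⟩
  1ℚ ℚ.+ s ℚ.* ι (+ S n)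
    ≡⟨ cong (1ℚ ℚ.+_) (ι-pos-* (suc n) (S n)) ⟨
  1ℚ ℚ.+ ι (+ (suc n ℕ.* S n))
    ≡⟨ ι-+ (+ 1) (+ (suc n ℕ.* S n)) ⟨
  ι (+ S (suc n)) ∎
  where
  open ≡-Reasoning
  open ℚS
  t′ = ι (+ (suc n !))
  t = ι (+ (n !))
  y = 1/ suc n !
  s = ι (+ suc n)

eSum-mono : ∀ {m n} → m ℕ.≤′ n → eSum m ℚ.≤ eSum n
eSum-mono ≤′-refl = ℚₚ.≤-refl
eSum-mono {m} {suc n} (≤′-step m≤n) = begin
  eSum m                  ≤⟨ eSum-mono m≤n ⟩
  eSum n                  ≡⟨ ℚₚ.+-identityʳ (eSum n) ⟨
  eSum n ℚ.+ 0ℚ           ≤⟨ ℚₚ.+-monoʳ-≤ (eSum n) (ℚₚ.nonNegative⁻¹ _ {{1/!-nonNeg (suc n)}}) ⟩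
  eSum n ℚ.+ 1/ suc n !   ∎
  where open ℚₚ.≤-Reasoning

-- Passing from n to n+1 replaces 1/n! by 2/(n+1)!, which is no larger once n+1 ≥ 2; this is where
-- `1 ≤ m` enters.
eSum+1/!-antimono : ∀ {m n} → 1 ℕ.≤ m → m ℕ.≤′ n → eSum n ℚ.+ 1/ n ! ℚ.≤ eSum m ℚ.+ 1/ m !
eSum+1/!-antimono _ ≤′-refl = ℚₚ.≤-refl
eSum+1/!-antimono {m} {suc n} 1≤m (≤′-step m≤n) = begin
  eSum n ℚ.+ y ℚ.+ y
    ≡⟨ solve 2 (λ e y → e :+ y :+ y := e :+ con (ι (+ 2)) :* y) refl (eSum n) y ⟩
  eSum n ℚ.+ ι (+ 2) ℚ.* y
    ≤⟨ ℚₚ.+-monoʳ-≤ (eSum n) (ℚₚ.*-monoʳ-≤-nonNeg y {{1/!-nonNeg (suc n)}}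
         (ι-mono-≤ (+≤+ (s≤s (ℕₚ.≤-trans 1≤m (ℕₚ.≤′⇒≤ m≤n)))))) ⟩
  eSum n ℚ.+ ι (+ suc n) ℚ.* y
    ≡⟨ cong (eSum n ℚ.+_) (1/!-suc n) ⟨
  eSum n ℚ.+ 1/ n !
    ≤⟨ eSum+1/!-antimono 1≤m m≤n ⟩
  eSum m ℚ.+ 1/ m ! ∎
  where
  open ℚₚ.≤-Reasoning
  open ℚS
  y = 1/ suc n !

-- The terms of the series beyond 1/m! add up to at most 1/m!, so after scaling by m! they exceed
-- `S m` by at most 1.
!*eSum≤ : ∀ {m n} → 1 ℕ.≤ m → m ℕ.≤ n → ι (+ (m !)) ℚ.* eSum n ℚ.≤ ι (+ suc (S m))
!*eSum≤ {m} {n} 1≤m m≤n = begin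
  t ℚ.* eSum n                 ≡⟨ cong (t ℚ.*_) (ℚₚ.+-identityʳ (eSum n)) ⟨
  t ℚ.* (eSum n ℚ.+ 0ℚ)
    ≤⟨ ℚₚ.*-monoˡ-≤-nonNeg t {{ι-nonNeg {m !}}}
         (ℚₚ.+-monoʳ-≤ (eSum n) (ℚₚ.nonNegative⁻¹ _ {{1/!-nonNeg n}})) ⟩
  t ℚ.* (eSum n ℚ.+ 1/ n !)
    ≤⟨ ℚₚ.*-monoˡ-≤-nonNeg t {{ι-nonNeg {m !}}} (eSum+1/!-antimono 1≤m (ℕₚ.≤⇒≤′ m≤n)) ⟩
  t ℚ.* (eSum m ℚ.+ 1/ m !)
    ≡⟨ solve 3 (λ t e x → t :* (e :+ x) := x :* t :+ t :* e) refl t (eSum m) (1/ m !) ⟩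
  1/ m ! ℚ.* t ℚ.+ t ℚ.* eSum m
    ≡⟨ cong₂ ℚ._+_ (1/!-inverse m) (!*eSum m) ⟩
  1ℚ ℚ.+ ι (+ S m)             ≡⟨ ι-+ (+ 1) (+ S m) ⟨
  ι (+ suc (S m))              ∎
  where
  open ℚₚ.≤-Reasoning
  open ℚS
  t = ι (+ (m !))

-- Testing the lower bound at precision 1/(2(k+1)) suffices, because
-- k! e ≤ S k + 2/(k+1) and 2(k+1) > 5.
≤!*e⇒≤S : ∀ {k f} → 2 ℕ.≤ k → fromℤ f ≤ᴿ fromℕ (k !) *ᴿ e → f ℤ.≤ + S k
≤!*e⇒≤S {k} {f} 2≤k f≤ with f≤ (+ 1 / (2 ℕ.* suc k)) (ℚₚ.positive⁻¹ _ {{ℚₚ.normalize-pos 1 (2 ℕ.* suc k)}})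
... | N , h = ℤₚ.i<j⇒i≤pred[j] (ℤₚ.*-cancelˡ-<-nonNeg {j = + suc (S k)} (+ d)
  (ℤₚ.≤-<-trans (ι-cancel-≤ scaled) (subst (+ (2 ℕ.* suc (S K) ℕ.+ 1) ℤ.<_) (ℤₚ.pos-* d (suc (S k))) (+<+ gap))))
  where
  -- At index `k` itself, `!*eSum≤` gives only k! e ≤ S k + 1, which does not exclude `f` = S k + 1.
  -- One index later the excess over S k is 2/K. Multiplying by `d` clears this denominator and that
  -- of the precision, leaving an inequality of integers.
  K = suc k
  d = 2 ℕ.* K
  m = N ℕ.⊔ K

  gap : 2 ℕ.* suc (S K) ℕ.+ 1 ℕ.< d ℕ.* suc (S k)
  gap = begin-strict
    2 ℕ.* suc (suc (K ℕ.* S k)) ℕ.+ 1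
      ≡⟨ solve 2 (λ k s → con 2 :* (con 2 :+ (con 1 :+ k) :* s) :+ con 1
           := con 5 :+ con 2 :* (con 1 :+ k) :* s) refl k (S k) ⟩
    5 ℕ.+ d ℕ.* S k
      <⟨ ℕₚ.+-monoˡ-≤ (d ℕ.* S k) (ℕₚ.*-monoʳ-≤ 2 (s≤s 2≤k)) ⟩
    d ℕ.+ d ℕ.* S k
      ≡⟨ ℕₚ.*-suc d (S k) ⟨
    d ℕ.* suc (S k) ∎
    where
    open ℕₚ.≤-Reasoning
    open ℕS

  scaled : ι (+ d ℤ.* f) ℚ.≤ ι (+ (2 ℕ.* suc (S K) ℕ.+ 1))
  scaled = begin
    ι (+ d ℤ.* f)
      ≡⟨ ι-* (+ d) f ⟩
    ι (+ d) ℚ.* ι f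
      ≤⟨ ℚₚ.*-monoˡ-≤-nonNeg (ι (+ d)) {{ι-nonNeg {d}}} (h m (ℕₚ.m≤m⊔n N K)) ⟩
    ι (+ d) ℚ.* (ι (+ (k !)) ℚ.* eSum m ℚ.+ + 1 / d)
      ≡⟨ solve 4 (λ d t e ε → d :* (t :* e :+ ε) := d :* (t :* e) :+ ε :* d)
           refl (ι (+ d)) (ι (+ (k !))) (eSum m) (+ 1 / d) ⟩
    ι (+ d) ℚ.* (ι (+ (k !)) ℚ.* eSum m) ℚ.+ (+ 1 / d) ℚ.* ι (+ d)
      ≡⟨ cong₂ ℚ._+_ regroup (/-*-cancel (+ 1) d) ⟩
    ι (+ 2) ℚ.* (ι (+ (K !)) ℚ.* eSum m) ℚ.+ ι (+ 1)
      ≤⟨ ℚₚ.+-monoˡ-≤ (ι (+ 1)) (ℚₚ.*-monoˡ-≤-nonNeg (ι (+ 2))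
           (!*eSum≤ (s≤s z≤n) (ℕₚ.m≤n⊔m N K))) ⟩
    ι (+ 2) ℚ.* ι (+ suc (S K)) ℚ.+ ι (+ 1)
      ≡⟨ cong (ℚ._+ ι (+ 1)) (ι-pos-* 2 (suc (S K))) ⟨
    ι (+ (2 ℕ.* suc (S K))) ℚ.+ ι (+ 1)
      ≡⟨ ι-+ (+ (2 ℕ.* suc (S K))) (+ 1) ⟨
    ι (+ (2 ℕ.* suc (S K) ℕ.+ 1)) ∎
    where
    open ℚₚ.≤-Reasoning
    open ℚS
    regroup : ι (+ d) ℚ.* (ι (+ (k !)) ℚ.* eSum m) ≡ ι (+ 2) ℚ.* (ι (+ (K !)) ℚ.* eSum m)
    regroup = trans (cong (ℚ._* (ι (+ (k !)) ℚ.* eSum m)) (ι-pos-* 2 K))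
      (trans (solve 4 (λ a b t e → a :* b :* (t :* e) := a :* (b :* t :* e)) refl
                (ι (+ 2)) (ι (+ K)) (ι (+ (k !))) (eSum m))
        (cong (λ z → ι (+ 2) ℚ.* (z ℚ.* eSum m)) (sym (ι-pos-* K (k !)))))

-- Propagation of the deficit from k to n.

suc-pred-R₃ : ∀ n → suc (ℕ.pred (R₃ n)) ≡ R₃ n
suc-pred-R₃ n = ℕₚ.suc-pred (R₃ n) {{ℕ.>-nonZero (proj₁ (R₃-isRamseyNumber n))}}

pred-R₃-step : ∀ n → ℕ.pred (R₃ (suc n)) ℕ.≤ suc (suc n ℕ.* ℕ.pred (R₃ n))
pred-R₃-step n = ramsey-step (R n) (R (suc n))
  where
  R : ∀ n → IsRamseyNumber n (suc (ℕ.pred (R₃ n)))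
  R n = subst (IsRamseyNumber n) (sym (suc-pred-R₃ n)) (R₃-isRamseyNumber n)

-- The division-free form of R n - 1 ≤ S n - a n!/k!, by induction along `≤′` starting at `k`.
pred-R₃-bound : ∀ {k a n} → ℕ.pred (R₃ k) ℕ.+ a ℕ.≤ S k → k ≤′ n →
                k ! ℕ.* ℕ.pred (R₃ n) ℕ.+ a ℕ.* n ! ℕ.≤ k ! ℕ.* S n
pred-R₃-bound {k} {a} base ≤′-refl = begin
  k ! ℕ.* ℕ.pred (R₃ k) ℕ.+ a ℕ.* k !   ≡⟨ cong (k ! ℕ.* ℕ.pred (R₃ k) ℕ.+_) (ℕₚ.*-comm a (k !)) ⟩
  k ! ℕ.* ℕ.pred (R₃ k) ℕ.+ k ! ℕ.* a   ≡⟨ ℕₚ.*-distribˡ-+ (k !) (ℕ.pred (R₃ k)) a ⟨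
  k ! ℕ.* (ℕ.pred (R₃ k) ℕ.+ a)         ≤⟨ ℕₚ.*-monoʳ-≤ (k !) base ⟩
  k ! ℕ.* S k                           ∎
  where open ℕₚ.≤-Reasoning
pred-R₃-bound {k} {a} {suc n} base (≤′-step k≤n) =
  scaled-bound-step (k !) a (suc n) (n !) (ℕ.pred (R₃ n)) (ℕ.pred (R₃ (suc n))) (S n)
    (pred-R₃-bound base k≤n) (pred-R₃-step n)

-- The `+ 1` in the bound on `a` cancels the difference between `R₃ k` and its predecessor, so that
-- bound says that `a` plus the predecessor is at most `f`.
pred-R₃-base : ∀ {k a f} → f ℤ.≤ + S k → + a ℤ.≤ f ℤ.- + R₃ k ℤ.+ + 1 →
               ℕ.pred (R₃ k) ℕ.+ a ℕ.≤ S k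
pred-R₃-base {k} {a} {f} f≤S a≤ = ℤₚ.drop‿+≤+ (begin
  + (M ℕ.+ a)                            ≤⟨ ℤₚ.+-monoʳ-≤ (+ M) a≤ ⟩
  + M ℤ.+ (f ℤ.- + R₃ k ℤ.+ + 1)
    ≡⟨ cong (λ r → + M ℤ.+ (f ℤ.- + r ℤ.+ + 1)) (suc-pred-R₃ k) ⟨
  + M ℤ.+ (f ℤ.- (+ 1 ℤ.+ + M) ℤ.+ + 1)
    ≡⟨ solve 2 (λ m f → m :+ (f :- (con (+ 1) :+ m) :+ con (+ 1)) := f) refl (+ M) f ⟩
  f                                      ≤⟨ f≤S ⟩
  + S k                                  ∎)
  where
  open ℤₚ.≤-Reasoning
  open ℤS
  M = ℕ.pred (R₃ k)

theorem2p5 : (k : ℕ) → 2 ℕ.≤ k →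
    (a : ℕ) (⌊k!e⌋ : ℤ) → IsFloor (fromℕ (k !) *ᴿ e) ⌊k!e⌋ →
    + a ℤ.≤ ⌊k!e⌋ ℤ.- + R₃ k ℤ.+ + 1 →
    let q = fromℚ ((+ a / k !) {{k !≢0}}) in
    (n : ℕ) → k ℕ.≤ n →
    fromℕ (R₃ n) ≤ᴿ fromℕ (n !) *ᴿ (e -ᴿ q) +ᴿ fromℕ 1
-- From index `n` on, the termwise inequality holds even without `ε`, because the partial sums
-- increase from `eSum n`.
theorem2p5 k 2≤k a f (f≤k!e , _) a≤ n k≤n ε 0<ε = n , λ m n≤m → begin
  ι (+ R₃ n)                    ≡⟨ cong (λ r → ι (+ r)) (suc-pred-R₃ n) ⟨
  ι (+ suc M)                   ≡⟨ ι-+ (+ 1) (+ M) ⟩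
  ι (+ 1) ℚ.+ ι (+ M)           ≡⟨ ℚₚ.+-comm (ι (+ 1)) (ι (+ M)) ⟩
  ι (+ M) ℚ.+ ι (+ 1)           ≤⟨ ℚₚ.+-monoˡ-≤ (ι (+ 1)) (ℚₚ.*-cancelˡ-≤-pos t {{ι!-pos {k}}} (scaled m n≤m)) ⟩
  w ℚ.* (eSum m ℚ.- q) ℚ.+ ι (+ 1)
                                ≡⟨ ℚₚ.+-identityʳ _ ⟨
  w ℚ.* (eSum m ℚ.- q) ℚ.+ ι (+ 1) ℚ.+ 0ℚ
                                ≤⟨ ℚₚ.+-monoʳ-≤ (w ℚ.* (eSum m ℚ.- q) ℚ.+ ι (+ 1)) (ℚₚ.<⇒≤ 0<ε) ⟩
  w ℚ.* (eSum m ℚ.- q) ℚ.+ ι (+ 1) ℚ.+ ε ∎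
  where
  open ℚₚ.≤-Reasoning
  open ℚS
  M = ℕ.pred (R₃ n)
  t = ι (+ (k !))
  w = ι (+ (n !))
  q = (+ a / k !) {{k !≢0}}

  integral : k ! ℕ.* M ℕ.+ a ℕ.* n ! ℕ.≤ k ! ℕ.* S n
  integral = pred-R₃-bound (pred-R₃-base {k} {a} {f} (≤!*e⇒≤S 2≤k f≤k!e) a≤) (ℕₚ.≤⇒≤′ k≤n)

  scaled : ∀ m → n ℕ.≤ m → t ℚ.* ι (+ M) ℚ.≤ t ℚ.* (w ℚ.* (eSum m ℚ.- q))
  scaled m n≤m = begin
    t ℚ.* ι (+ M)
      -- The product of `a` and n! is added and removed so that `integral` applies; since `a` is `q`
      -- times k!, the removed copy ends up as the term with `q`.
      ≡⟨ solve 3 (λ x b w → x := x :+ b :* w :- b :* w) refl (t ℚ.* ι (+ M)) (ι (+ a)) w ⟩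
    t ℚ.* ι (+ M) ℚ.+ ι (+ a) ℚ.* w ℚ.- ι (+ a) ℚ.* w
      ≡⟨ cong (ℚ._- ι (+ a) ℚ.* w) (cong₂ ℚ._+_ (ι-pos-* (k !) M) (ι-pos-* a (n !))) ⟨
    ι (+ (k ! ℕ.* M)) ℚ.+ ι (+ (a ℕ.* n !)) ℚ.- ι (+ a) ℚ.* w
      ≡⟨ cong (ℚ._- ι (+ a) ℚ.* w) (ι-+ (+ (k ! ℕ.* M)) (+ (a ℕ.* n !))) ⟨
    ι (+ (k ! ℕ.* M ℕ.+ a ℕ.* n !)) ℚ.- ι (+ a) ℚ.* w
      ≤⟨ ℚₚ.+-monoˡ-≤ (ℚ.- (ι (+ a) ℚ.* w)) (ι-mono-≤ (+≤+ integral)) ⟩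
    ι (+ (k ! ℕ.* S n)) ℚ.- ι (+ a) ℚ.* w
      ≡⟨ cong (ℚ._- ι (+ a) ℚ.* w)
           (trans (ι-pos-* (k !) (S n)) (cong (t ℚ.*_) (sym (!*eSum n)))) ⟩
    t ℚ.* (w ℚ.* eSum n) ℚ.- ι (+ a) ℚ.* w
      ≤⟨ ℚₚ.+-monoˡ-≤ (ℚ.- (ι (+ a) ℚ.* w))
           (ℚₚ.*-monoˡ-≤-nonNeg t {{ι-nonNeg {k !}}}
             (ℚₚ.*-monoˡ-≤-nonNeg w {{ι-nonNeg {n !}}} (eSum-mono (ℕₚ.≤⇒≤′ n≤m)))) ⟩
    t ℚ.* (w ℚ.* eSum m) ℚ.- ι (+ a) ℚ.* w
      ≡⟨ cong (λ z → t ℚ.* (w ℚ.* eSum m) ℚ.- z ℚ.* w) (/-*-cancel (+ a) (k !) {{k !≢0}}) ⟨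
    t ℚ.* (w ℚ.* eSum m) ℚ.- q ℚ.* t ℚ.* w
      ≡⟨ solve 4 (λ t w e q → t :* (w :* e) :- q :* t :* w := t :* (w :* (e :- q)))
           refl t w (eSum m) q ⟩
    t ℚ.* (w ℚ.* (eSum m ℚ.- q)) ∎
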